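{- Let $k \ge 1$ be an integer and let $\mathbf{A} \in \{0,1\}^{d \times n}$ be any binary matrix. Then there exist $\mathbf{P}_A \in \{0,1\}^{d \times k}$, whose $k$ columns are chosen from the columns of $\mathbf{A}$, and $\mathbf{Q} \in \{0,1\}^{k \times n}$ such that \[ \|\mathbf{A} - \mathbf{P}_A \mathbf{Q}\|_F^2 \le \left(\frac{k}{2} + 1 + \frac{k}{2(2^k-1)}\right) \mathrm{OPT}_k, \] where $\mathrm{OPT}_k := \min_{\mathbf{U} \in \{0,1\}^{d\times k},\, \mathbf{V} \in \{0,1\}^{k \times n}} \|\mathbf{A} - \mathbf{U}\mathbf{V}\|_F^2$. All matrix products are computed over $\mathrm{GF}(2)$.
   Context: All matrices are binary and all matrix operations (products, sums) are over the field $\mathrm{GF}(2)$. For a binary matrix $\mathbf{M}$, $\|\mathbf{M}\|_F^2$ is the number of entries of $\mathbf{M}$ equal to $1$. -}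

module Defs where

open import Data.Nat using (ℕ; zero; suc; _+_; _*_)
open import Data.Bool using (Bool; true; false; _xor_; _∧_)
open import Data.Fin using (Fin; zero; suc)

Mat : ℕ → ℕ → Set
Mat d n = Fin d → Fin n → Bool

∑ : (n : ℕ) → (Fin n → ℕ) → ℕ
∑ zero    f = 0
∑ (suc n) f = f zero + ∑ n (λ i → f (suc i))

⊕ : (n : ℕ) → (Fin n → Bool) → Bool
⊕ zero    f = false
⊕ (suc n) f = f zero xor ⊕ n (λ i → f (suc i))

_·_ : ∀ {d k n} → Mat d k → Mat k n → Mat d n
_·_ {k = k} U V i j = ⊕ k (λ l → U i l ∧ V l j)

_−_ : ∀ {d n} → Mat d n → Mat d n → Mat d n
(A − B) i j = A i j xor B i j

bit : Bool → ℕ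
bit true  = 1
bit false = 0

‖_‖² : ∀ {d n} → Mat d n → ℕ
‖_‖² {d} {n} M = ∑ d (λ i → ∑ n (λ j → bit (M i j)))

IsOPT : ∀ {d n} (k : ℕ) → Mat d n → ℕ → Set
IsOPT {d} {n} k A m =
  (Σ' (Mat d k) λ U → Σ' (Mat k n) λ V → ‖ A − (U · V) ‖² ≡' m)
  ×' ((U : Mat d k) (V : Mat k n) → m ≤' ‖ A − (U · V) ‖²)
  where
    open import Data.Product renaming (Σ to Σ'; _×_ to _×'_)
    open import Relation.Binary.PropositionalEquality renaming (_≡_ to _≡'_)
    open import Data.Nat renaming (_≤_ to _≤'_)

selectCols : ∀ {d n k} → Mat d n → (Fin k → Fin n) → Mat d k
selectCols A σ i j = A i (σ j)

{-# OPTIONS --safe #-}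

-- Let A ≈ U V be optimal, let e j be the number of errors in column j, and let V j denote column j of V.
-- Replacing U by columns T = (t₁ … tᵣ) of A for which V t₁ … V tᵣ is a basis of the column space of V
-- adds at most Σᵢ e tᵢ · N Hᵢ errors, where Hᵢ is spanned by the V tₗ with l ≠ i and N H is the number
-- of columns outside H. Draw T with probability proportional to Π 1 / e tᵢ. By symmetry the expected
-- increase is proportional to Q = Σ N(H)², taken over (r-1)-tuples spanning hyperplanes H, with the same
-- weights, and Q is bounded by induction on the rank r, passing to the quotient by the first column t.
-- The quotient forgets the columns parallel to t; what is lost there is recovered from
-- Cauchy–Schwarz over the 2ʳ⁻¹ classes outside H, and the two estimates add up to the factor
-- 2ʳ⁻¹ / (2ʳ - 1).
module Submission where

open import Defs
open import Data.Nat using (ℕ; zero; suc; _+_; _*_; _∸_; _^_; _≤_; z≤n; s≤s; s≤s⁻¹; _<_; >-nonZero; _≤′_; ≤′-refl; ≤′-step)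
open import Data.Nat.Properties hiding (_≟_)
open import Data.Nat.ListAction using (sum)
open import Data.Nat.ListAction.Properties using (sum-++)
open import Data.Nat.Tactic.RingSolver using (solve-∀)
open import Data.Bool using (Bool; true; false; _xor_; _∧_; _∨_; not)
open import Data.Bool.Properties using (xor-assoc; xor-comm; xor-same; xor-identityʳ; ∨-comm; ∨-zeroʳ; ∧-zeroʳ; ∧-identityʳ; ∧-distribˡ-xor; ¬-not; _≟_)
open import Data.Fin using (Fin; zero; suc)
open import Data.Fin.Properties using (any?)
open import Data.List using (List; []; _∷_; map; _++_; allFin)
open import Data.List.Properties using (map-++; map-∘; map-cong; map-tabulate)
open import Data.Vec using (Vec; []; _∷_; zipWith; replicate; lookup; padRight; tabulate)
open import Data.Vec.Properties using (zipWith-assoc; zipWith-comm; zipWith-identityʳ)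
open import Data.Product using (Σ; ∃-syntax; _×_; _,_; proj₁; proj₂)
open import Data.Sum using (_⊎_; inj₁; inj₂)
open import Data.Unit using (⊤; tt)
open import Function using (_∘_; id)
open import Relation.Nullary using (¬_; yes; no; contradiction)
open import Relation.Binary.PropositionalEquality

-- Sums over lists

S : {A : Set} → List A → (A → ℕ) → ℕ
S xs f = sum (map f xs)

module _ {A : Set} where

  S-cong : (xs : List A) {f g : A → ℕ} → (∀ x → f x ≡ g x) → S xs f ≡ S xs g
  S-cong xs h = cong sum (map-cong h xs)

  S-mono : (xs : List A) {f g : A → ℕ} → (∀ x → f x ≤ g x) → S xs f ≤ S xs g
  S-mono []       h = z≤n
  S-mono (x ∷ xs) h = +-mono-≤ (h x) (S-mono xs h)

  S-+ : (xs : List A) (f g : A → ℕ) → S xs (λ x → f x + g x) ≡ S xs f + S xs g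
  S-+ []       f g = refl
  S-+ (x ∷ xs) f g = trans (cong (f x + g x +_) (S-+ xs f g)) (+-interchange (f x) (g x) _ _)
    where
    +-interchange : ∀ a b c d → a + b + (c + d) ≡ a + c + (b + d)
    +-interchange = solve-∀

  S-*ˡ : (xs : List A) (c : ℕ) (f : A → ℕ) → S xs (λ x → c * f x) ≡ c * S xs f
  S-*ˡ []       c f = sym (*-zeroʳ c)
  S-*ˡ (x ∷ xs) c f = trans (cong (c * f x +_) (S-*ˡ xs c f)) (sym (*-distribˡ-+ c (f x) _))

  S-*ʳ : (xs : List A) (c : ℕ) (f : A → ℕ) → S xs (λ x → f x * c) ≡ S xs f * c
  S-*ʳ xs c f = trans (S-cong xs (λ x → *-comm (f x) c)) (trans (S-*ˡ xs c f) (*-comm c _))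

  S-zero : (xs : List A) → S xs (λ _ → 0) ≡ 0
  S-zero []       = refl
  S-zero (x ∷ xs) = S-zero xs

  S-++ : (xs ys : List A) (f : A → ℕ) → S (xs ++ ys) f ≡ S xs f + S ys f
  S-++ xs ys f = trans (cong sum (map-++ f xs ys)) (sum-++ (map f xs) (map f ys))

S-map : {A B : Set} (g : A → B) (xs : List A) (f : B → ℕ) → S (map g xs) f ≡ S xs (f ∘ g)
S-map g xs f = cong sum (sym (map-∘ xs))

module _ {A B : Set} where

  S-swap : (xs : List A) (ys : List B) (f : A → B → ℕ) →
    S xs (λ x → S ys (f x)) ≡ S ys (λ y → S xs (λ x → f x y))
  S-swap []       ys f = sym (S-zero ys)
  S-swap (x ∷ xs) ys f = trans (cong (S ys (f x) +_) (S-swap xs ys f)) (sym (S-+ ys (f x) _))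

  S-*-S : (xs : List A) (ys : List B) (f : A → ℕ) (g : B → ℕ) →
    S xs f * S ys g ≡ S xs (λ x → S ys (λ y → f x * g y))
  S-*-S xs ys f g =
    trans (sym (S-*ʳ xs (S ys g) f)) (S-cong xs (λ x → sym (S-*ˡ ys (f x) g)))

∑≡S : ∀ n (f : Fin n → ℕ) → ∑ n f ≡ S (allFin n) f
∑≡S zero    f = refl
∑≡S (suc n) f = cong (f zero +_) (trans (∑≡S n (f ∘ suc))
  (cong sum (trans (map-tabulate id (f ∘ suc)) (sym (map-tabulate suc f)))))

-- The pairwise hypothesis is what survives of c u ² D ≤ x u * e u after symmetrising.
weighted-cauchy : {A : Set} (xs : List A) (D : ℕ) (p c x e : A → ℕ) →
  (∀ u w → 2 * (D * (c u * c w)) ≤ x u * e w + x w * e u) →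
  D * (S xs (λ u → p u * c u) * S xs (λ u → p u * c u))
    ≤ S xs (λ u → p u * x u) * S xs (λ u → p u * e u)
weighted-cauchy xs D p c x e h = *-cancelˡ-≤ 2 (begin
  2 * (D * (S xs pc * S xs pc))
    ≡⟨ *-assoc 2 D _ ⟨
  2 * D * (S xs pc * S xs pc)
    ≡⟨ cong (2 * D *_) (S-*-S xs xs pc pc) ⟩
  2 * D * S xs (λ u → S xs (λ w → pc u * pc w))
    ≡⟨ pull ⟨
  S xs (λ u → S xs (λ w → 2 * D * (pc u * pc w)))
    ≤⟨ S-mono xs (λ u → S-mono xs (λ w → pair u w)) ⟩
  S xs (λ u → S xs (λ w → px u * pe w + pe u * px w))
    ≡⟨ trans (S-cong xs (λ u → S-+ xs _ _)) (S-+ xs _ _) ⟩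
  S xs (λ u → S xs (λ w → px u * pe w)) + S xs (λ u → S xs (λ w → pe u * px w))
    ≡⟨ cong₂ _+_ (S-*-S xs xs px pe) (S-*-S xs xs pe px) ⟨
  S xs px * S xs pe + S xs pe * S xs px
    ≡⟨ twice (S xs px) (S xs pe) ⟩
  2 * (S xs px * S xs pe) ∎)
  where
  open ≤-Reasoning
  pc px pe : _ → ℕ
  pc u = p u * c u
  px u = p u * x u
  pe u = p u * e u
  pull : S xs (λ u → S xs (λ w → 2 * D * (pc u * pc w))) ≡ 2 * D * S xs (λ u → S xs (λ w → pc u * pc w))
  pull = trans (S-cong xs (λ u → S-*ˡ xs (2 * D) _)) (S-*ˡ xs (2 * D) _)
  twice : ∀ a b → a * b + b * a ≡ 2 * (a * b)
  twice = solve-∀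
  left : ∀ D p q a b → 2 * D * (p * a * (q * b)) ≡ p * q * (2 * (D * (a * b)))
  left = solve-∀
  right : ∀ p q a b a' b' → p * q * (a * b' + a' * b) ≡ p * a * (q * b') + p * b * (q * a')
  right = solve-∀
  pair : ∀ u w → 2 * D * (pc u * pc w) ≤ px u * pe w + pe u * px w
  pair u w = begin
    2 * D * (pc u * pc w)                        ≡⟨ left D (p u) (p w) (c u) (c w) ⟩
    p u * p w * (2 * (D * (c u * c w)))          ≤⟨ *-monoʳ-≤ (p u * p w) (h u w) ⟩
    p u * p w * (x u * e w + x w * e u)          ≡⟨ right (p u) (p w) (x u) (e u) (x w) (e w) ⟩
    px u * pe w + pe u * px w                    ∎

-- The two sides differ by the square of the gap `d`; ordering `a` and `b` first avoids truncated
-- subtraction.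
2ab≤a²+b² : ∀ a b → 2 * (a * b) ≤ a * a + b * b
2ab≤a²+b² a b with ≤-total a b
... | inj₁ a≤b with m≤n⇒∃[o]m+o≡n a≤b
...   | d , refl = subst (2 * (a * (a + d)) ≤_) (expand a d) (m≤m+n _ (d * d))
  where
  expand : ∀ a d → 2 * (a * (a + d)) + d * d ≡ a * a + (a + d) * (a + d)
  expand = solve-∀
2ab≤a²+b² a b | inj₂ b≤a with m≤n⇒∃[o]m+o≡n b≤a
...   | d , refl = subst (2 * ((b + d) * b) ≤_) (expand b d) (m≤m+n _ (d * d))
  where
  expand : ∀ b d → 2 * ((b + d) * b) + d * d ≡ (b + d) * (b + d) + b * b
  expand = solve-∀

-- (p + q)² ≥ 4pq = (2D)².
2D≤p+q : ∀ {p q D} → p * q ≡ D * D → 2 * D ≤ p + q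
2D≤p+q {p} {q} {D} pq≡D² = ≮⇒≥ λ p+q<2D → <⇒≱ (*-mono-< p+q<2D p+q<2D) (begin
  2 * D * (2 * D)              ≡⟨ four D ⟩
  2 * (D * D) + 2 * (D * D)    ≡⟨ cong (λ t → 2 * t + 2 * t) pq≡D² ⟨
  2 * (p * q) + 2 * (p * q)    ≤⟨ +-monoˡ-≤ _ (2ab≤a²+b² p q) ⟩
  p * p + q * q + 2 * (p * q)  ≡⟨ square p q ⟩
  (p + q) * (p + q)            ∎)
  where
  open ≤-Reasoning
  four : ∀ D → 2 * D * (2 * D) ≡ 2 * (D * D) + 2 * (D * D)
  four = solve-∀
  square : ∀ p q → p * p + q * q + 2 * (p * q) ≡ (p + q) * (p + q)
  square = solve-∀

-- Subspaces of GF(2)ᵏ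

_⊞_ : ∀ {k} → Vec Bool k → Vec Bool k → Vec Bool k
_⊞_ = zipWith _xor_

infixl 6 _⊞_

𝟎 : ∀ {k} → Vec Bool k
𝟎 = replicate _ false

⊞-assoc : ∀ {k} (u v w : Vec Bool k) → u ⊞ v ⊞ w ≡ u ⊞ (v ⊞ w)
⊞-assoc = zipWith-assoc xor-assoc

⊞-comm : ∀ {k} (u v : Vec Bool k) → u ⊞ v ≡ v ⊞ u
⊞-comm = zipWith-comm xor-comm

⊞-identityʳ : ∀ {k} (u : Vec Bool k) → u ⊞ 𝟎 ≡ u
⊞-identityʳ = zipWith-identityʳ xor-identityʳ

⊞-self : ∀ {k} (u : Vec Bool k) → u ⊞ u ≡ 𝟎
⊞-self []      = refl
⊞-self (b ∷ u) = cong₂ _∷_ (xor-same b) (⊞-self u)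

⊞-cancelʳ : ∀ {k} (u v : Vec Bool k) → u ⊞ v ⊞ v ≡ u
⊞-cancelʳ u v = trans (⊞-assoc u v v) (trans (cong (u ⊞_) (⊞-self v)) (⊞-identityʳ u))

⊞-rightComm : ∀ {k} (u v w : Vec Bool k) → u ⊞ v ⊞ w ≡ u ⊞ w ⊞ v
⊞-rightComm u v w = trans (⊞-assoc u v w) (trans (cong (u ⊞_) (⊞-comm v w)) (sym (⊞-assoc u w v)))

allVec : ∀ k → List (Vec Bool k)
allVec zero    = [] ∷ []
allVec (suc k) = map (false ∷_) (allVec k) ++ map (true ∷_) (allVec k)

S-allVec : ∀ k (f : Vec Bool (suc k) → ℕ) →
  S (allVec (suc k)) f ≡ S (allVec k) (f ∘ (false ∷_)) + S (allVec k) (f ∘ (true ∷_))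
S-allVec k f = trans (S-++ (map (false ∷_) (allVec k)) _ f)
  (cong₂ _+_ (S-map (false ∷_) (allVec k) f) (S-map (true ∷_) (allVec k) f))

-- Translation permutes the vectors: a leading `false` keeps the two halves of the list in place, a
-- leading `true` interchanges them.
S-translate : ∀ k (u : Vec Bool k) (f : Vec Bool k → ℕ) →
  S (allVec k) (λ v → f (v ⊞ u)) ≡ S (allVec k) f
S-translate zero    []          f = refl
S-translate (suc k) (false ∷ u) f = trans (S-allVec k (λ v → f (v ⊞ (false ∷ u)))) (trans
  (cong₂ _+_ (S-translate k u (f ∘ (false ∷_))) (S-translate k u (f ∘ (true ∷_))))
  (sym (S-allVec k f)))
S-translate (suc k) (true ∷ u)  f = trans (S-allVec k (λ v → f (v ⊞ (true ∷ u)))) (trans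
  (cong₂ _+_ (S-translate k u (f ∘ (true ∷_))) (S-translate k u (f ∘ (false ∷_))))
  (trans (+-comm (S (allVec k) (f ∘ (true ∷_))) _) (sym (S-allVec k f))))

-- Boolean-valued, so that membership is decidable and can be counted by `bit`.
Subset : ℕ → Set
Subset k = Vec Bool k → Bool

size : ∀ {k} → Subset k → ℕ
size {k} W = S (allVec k) (λ v → bit (W v))

size-full : ∀ k → size {k} (λ _ → true) ≡ 2 ^ k
size-full zero    = refl
size-full (suc k) = trans (S-allVec k _) (trans
  (cong₂ _+_ (size-full k) (size-full k)) (double (2 ^ k)))
  where
  double : ∀ a → a + a ≡ 2 * a
  double = solve-∀

isZero : ∀ {k} → Subset k
isZero []      = true
isZero (b ∷ v) = not b ∧ isZero v

isZero-𝟎 : ∀ k → isZero (𝟎 {k}) ≡ true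
isZero-𝟎 zero    = refl
isZero-𝟎 (suc k) = isZero-𝟎 k

isZero⇒≡𝟎 : ∀ {k} (v : Vec Bool k) → isZero v ≡ true → v ≡ 𝟎
isZero⇒≡𝟎 []          _ = refl
isZero⇒≡𝟎 (false ∷ v) p = cong (false ∷_) (isZero⇒≡𝟎 v p)

size-isZero : ∀ k → size (isZero {k}) ≡ 1
size-isZero zero    = refl
size-isZero (suc k) = trans (S-allVec k _) (cong₂ _+_ (size-isZero k) (S-zero (allVec k)))

_⊆_ : ∀ {k} → Subset k → Subset k → Set
W ⊆ Y = ∀ v → W v ≡ true → Y v ≡ true

bit-mono : ∀ {b c} → (b ≡ true → c ≡ true) → bit b ≤ bit c
bit-mono {false} h = z≤n
bit-mono {true}  h = ≤-reflexive (cong bit (sym (h refl)))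

size-mono : ∀ {k} {W Y : Subset k} → W ⊆ Y → size W ≤ size Y
size-mono {k} W⊆Y = S-mono (allVec k) (λ v → bit-mono (W⊆Y v))

size≤2^k : ∀ {k} (W : Subset k) → size W ≤ 2 ^ k
size≤2^k {k} W = subst (size W ≤_) (size-full k) (size-mono {W = W} (λ _ _ → refl))

-- Closure under addition is encoded as invariance of membership under translation by a member, an
-- equation that can be rewritten in both directions.
record IsSubspace {k} (W : Subset k) : Set where
  field
    0∈    : W 𝟎 ≡ true
    shift : ∀ {u} v → W u ≡ true → W (v ⊞ u) ≡ W v

  +∈ : ∀ {u v} → W u ≡ true → W v ≡ true → W (u ⊞ v) ≡ true
  +∈ {u} p q = trans (shift u q) p

  -- Over GF(2), adding `u ⊞ v` carries `v` to `u`, so membership is constant on cosets.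
  shift⁻ : ∀ {u v} → W (u ⊞ v) ≡ true → W u ≡ W v
  shift⁻ {u} {v} p =
    trans (cong W (sym (trans (⊞-comm v (u ⊞ v)) (⊞-cancelʳ u v)))) (shift v p)

open IsSubspace

isZero-subspace : ∀ {k} → IsSubspace (isZero {k})
isZero-subspace {k} .0∈ = isZero-𝟎 k
isZero-subspace .shift {u} v p rewrite isZero⇒≡𝟎 u p = cong isZero (⊞-identityʳ v)

-- The span of W and t, for a subspace W.
_⊹_ : ∀ {k} → Subset k → Vec Bool k → Subset k
(W ⊹ t) v = W v ∨ W (v ⊞ t)

infixl 5 _⊹_

⊹-cong : ∀ {k} {W W' : Subset k} → W ≗ W' → ∀ t → W ⊹ t ≗ W' ⊹ t
⊹-cong eq t v = cong₂ _∨_ (eq v) (eq (v ⊞ t))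

⊹-comm : ∀ {k} (W : Subset k) t u → W ⊹ t ⊹ u ≗ W ⊹ u ⊹ t
⊹-comm W t u v = trans (∨-mid (W v) _ _ _)
  (cong (λ z → (W v ∨ W (v ⊞ u)) ∨ (W (v ⊞ t) ∨ z)) (cong W (⊞-rightComm v u t)))
  where
  ∨-mid : ∀ a b c d → (a ∨ b) ∨ (c ∨ d) ≡ (a ∨ c) ∨ (b ∨ d)
  ∨-mid true  b     c     d = refl
  ∨-mid false true  true  d = refl
  ∨-mid false true  false d = refl
  ∨-mid false false c     d = refl

⊆-⊹ : ∀ {k} (W : Subset k) t → W ⊆ (W ⊹ t)
⊆-⊹ W t v p rewrite p = refl

∨-true : ∀ a {b} → a ∨ b ≡ true → (a ≡ true) ⊎ (b ≡ true)
∨-true true  p = inj₁ refl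
∨-true false p = inj₂ p

∨-false : ∀ a {b} → a ∨ b ≡ false → (a ≡ false) × (b ≡ false)
∨-false false p = refl , p

true≢false : ∀ {b} → b ≡ true → ¬ (b ≡ false)
true≢false refl ()

module _ {k} {W : Subset k} (sub : IsSubspace W) where

  ⊹-subspace : ∀ t → IsSubspace (W ⊹ t)
  ⊹-subspace t .0∈ = ⊆-⊹ W t 𝟎 (0∈ sub)
  ⊹-subspace t .shift {u} v p with ∨-true (W u) p
  ... | inj₁ q = cong₂ _∨_ (shift sub v q)
    (trans (cong W (⊞-rightComm v u t)) (shift sub (v ⊞ t) q))
  -- Here `u` lies in the translate of `W` by `t`, so adding `u` interchanges `W` and that
  -- translate.
  ... | inj₂ q = trans (cong₂ _∨_
      (trans (cong W (sym (⊞-cancelʳ (v ⊞ u) t))) (trans (cong W flip) (shift sub (v ⊞ t) q)))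
      (trans (cong W (⊞-assoc v u t)) (shift sub v q)))
      (∨-comm (W (v ⊞ t)) (W v))
    where
    flip : v ⊞ u ⊞ t ⊞ t ≡ v ⊞ t ⊞ (u ⊞ t)
    flip = trans (cong (_⊞ t) (⊞-rightComm v u t)) (⊞-assoc (v ⊞ t) u t)

  t∈⊹ : ∀ t → (W ⊹ t) t ≡ true
  t∈⊹ t = trans (cong (λ z → W t ∨ W z) (⊞-self t)) (trans (cong (W t ∨_) (0∈ sub)) (∨-zeroʳ (W t)))

  -- W and its translate by t are disjoint.
  bit-⊹ : ∀ {t} → W t ≡ false → ∀ v → bit ((W ⊹ t) v) ≡ bit (W v) + bit (W (v ⊞ t))
  bit-⊹ {t} t∉W v with W v in eq
  ... | false = refl
  ... | true  with W (v ⊞ t) in eq'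
  ...   | false = refl
  ...   | true  = contradiction t∉W
    (true≢false (trans (sym (shift⁻ sub eq')) eq))

  size-⊹ : ∀ {t} → W t ≡ false → size (W ⊹ t) ≡ 2 * size W
  size-⊹ {t} t∉W = trans (S-cong (allVec k) (bit-⊹ t∉W)) (trans (S-+ (allVec k) _ _)
    (trans (cong (size W +_) (S-translate k t (λ v → bit (W v)))) (double (size W))))
    where
    double : ∀ a → a + a ≡ 2 * a
    double = solve-∀

  ⊹-⊆ : ∀ {Y t} → IsSubspace Y → W ⊆ Y → Y t ≡ true → (W ⊹ t) ⊆ Y
  ⊹-⊆ {Y} {t} subY W⊆Y t∈Y v p with ∨-true (W v) p
  ... | inj₁ q = W⊆Y v q
  ... | inj₂ q = trans (sym (shift subY v t∈Y)) (W⊆Y _ q)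

  size>0 : 1 ≤ size W
  size>0 = subst (_≤ size W) (size-isZero k) (size-mono λ v p →
    subst (λ u → W u ≡ true) (sym (isZero⇒≡𝟎 v p)) (0∈ sub))

  -- A vector `v` of `Y` outside `W` would make `W ⊹ v` a part of `Y` with twice as many elements as
  -- `W`.
  ⊆-size-antisym : ∀ {Y} → IsSubspace Y → W ⊆ Y → size Y ≤ size W → Y ⊆ W
  ⊆-size-antisym {Y} subY W⊆Y Y≤W v v∈Y with W v in eq
  ... | true  = refl
  ... | false = contradiction (begin-strict
    size W       <⟨ m<m+n (size W) (≤-trans size>0 (≤-reflexive (sym (+-identityʳ _)))) ⟩
    2 * size W   ≡⟨ size-⊹ eq ⟨
    size (W ⊹ v) ≤⟨ size-mono (⊹-⊆ subY W⊆Y v∈Y) ⟩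
    size Y       ≤⟨ Y≤W ⟩
    size W       ∎) (<-irrefl refl)
    where open ≤-Reasoning

-- Columns of V and bases chosen among them

module Columns {k n : ℕ} (V : Fin n → Vec Bool k) where

  span : ∀ {r} → Subset k → Vec (Fin n) r → Subset k
  span W []      = W
  span W (t ∷ T) = span (W ⊹ V t) T

  Indep : ∀ {r} → Subset k → Vec (Fin n) r → Set
  Indep W []      = ⊤
  Indep W (t ∷ T) = W (V t) ≡ false × Indep (W ⊹ V t) T

  span-cong : ∀ {r} {W W' : Subset k} → W ≗ W' → (T : Vec (Fin n) r) → span W T ≗ span W' T
  span-cong eq []      = eq
  span-cong eq (t ∷ T) = span-cong (⊹-cong eq (V t)) T

  span-⊹ : ∀ {r} (W : Subset k) u (T : Vec (Fin n) r) → span (W ⊹ u) T ≗ span W T ⊹ u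
  span-⊹ W u []      v = refl
  span-⊹ W u (t ∷ T) v = trans (span-cong (⊹-comm W u (V t)) T v) (span-⊹ (W ⊹ V t) u T v)

  Indep-cong : ∀ {r} {W W' : Subset k} → W ≗ W' → (T : Vec (Fin n) r) → Indep W T → Indep W' T
  Indep-cong eq []      _       = tt
  Indep-cong eq (t ∷ T) (p , q) = trans (sym (eq (V t))) p , Indep-cong (⊹-cong eq (V t)) T q

  -- `Indep` tests a column only against its predecessors. By exchanging neighbours, the later
  -- columns are absorbed one by one into the base space ahead of `t`, so `t` is tested against its
  -- successors as well.
  Indep⇒head∉span : ∀ {r} {W : Subset k} {t} (T : Vec (Fin n) r) →
    Indep W (t ∷ T) → span W T (V t) ≡ false
  Indep⇒head∉span []                  (t∉W , _)       = t∉W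
  Indep⇒head∉span {W = W} {t} (s ∷ T) (t∉W , s∉ , ind) with ∨-false (W (V s)) s∉
  ... | _ , s+t∉W = Indep⇒head∉span T
    ( cong₂ _∨_ t∉W (trans (cong W (⊞-comm (V t) (V s))) s+t∉W)
    , Indep-cong (⊹-comm W (V t) (V s)) T ind )

  ⊆-span : ∀ {r} (W : Subset k) (T : Vec (Fin n) r) → W ⊆ span W T
  ⊆-span W []      v p = p
  ⊆-span W (t ∷ T) v p = ⊆-span (W ⊹ V t) T v (⊆-⊹ W (V t) v p)

  span-subspace : ∀ {r} {W : Subset k} → IsSubspace W → (T : Vec (Fin n) r) → IsSubspace (span W T)
  span-subspace sub []      = sub
  span-subspace sub (t ∷ T) = span-subspace (⊹-subspace sub (V t)) T

  span-⊆ : ∀ {r} {W Y : Subset k} → IsSubspace W → IsSubspace Y → W ⊆ Y → (∀ j → Y (V j) ≡ true) →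
    (T : Vec (Fin n) r) → span W T ⊆ Y
  span-⊆ sub subY W⊆Y V∈Y []      = W⊆Y
  span-⊆ sub subY W⊆Y V∈Y (t ∷ T) =
    span-⊆ (⊹-subspace sub (V t)) subY (⊹-⊆ sub subY W⊆Y (V∈Y t)) V∈Y T

  size-span : ∀ {r} {W : Subset k} → IsSubspace W → (T : Vec (Fin n) r) → Indep W T →
    size (span W T) ≡ size W * 2 ^ r
  size-span {W = W} sub [] _ = sym (*-identityʳ (size W))
  size-span {suc r} {W} sub (t ∷ T) (t∉W , ind) = trans
    (size-span (⊹-subspace sub (V t)) T ind)
    (trans (cong (_* 2 ^ r) (size-⊹ sub t∉W)) (assoc (size W) (2 ^ r)))
    where
    assoc : ∀ a b → 2 * a * b ≡ a * (2 * b)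
    assoc = solve-∀

  out : Subset k → Fin n → ℕ
  out W j = bit (not (W (V j)))

  out-cong : ∀ {W W' : Subset k} → W ≗ W' → ∀ j → out W j ≡ out W' j
  out-cong eq j = cong (bit ∘ not) (eq (V j))

  -- Both sides indicate that none of `V s`, `V t` and their sum lies in `W`, a condition symmetric
  -- in `s` and `t`.
  out-exchange : ∀ (W : Subset k) s t → out W t * out (W ⊹ V t) s ≡ out W s * out (W ⊹ V s) t
  out-exchange W s t rewrite ⊞-comm (V s) (V t) with W (V s) | W (V t) | W (V t ⊞ V s)
  ... | true  | true  | _     = refl
  ... | true  | false | _     = refl
  ... | false | true  | _     = refl
  ... | false | false | true  = refl
  ... | false | false | false = refl

  Σᶜ : (Fin n → ℕ) → ℕ
  Σᶜ = S (allFin n)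

  N : Subset k → ℕ
  N W = Σᶜ (out W)

  -- The increase of the error when the columns T replace their approximations: column tᵢ enters the
  -- representation of exactly those columns that lie outside the span of the others.
  cost : ∀ {r} → (Fin n → ℕ) → Subset k → Vec (Fin n) r → ℕ
  cost e W []      = 0
  cost e W (t ∷ T) = e t * N (span W T) + cost e (W ⊹ V t) T

  -- Weighted sums over independent tuples

  module Weighted (x : Fin n → ℕ) where

    -- The factors `out` vanish on dependent tuples. This is therefore the sum of `f` over ordered
    -- tuples independent modulo `W`, weighted by the product of their `x t`; divided by its value
    -- at the constant 1 it is an expectation.
    basisSum : ∀ r → Subset k → (Vec (Fin n) r → ℕ) → ℕ
    basisSum zero    W f = f []
    basisSum (suc r) W f = Σᶜ λ t → out W t * (x t * basisSum r (W ⊹ V t) (λ T → f (t ∷ T)))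

    basisSum-cong : ∀ r {W W' : Subset k} {f g} → W ≗ W' → (∀ T → f T ≡ g T) →
      basisSum r W f ≡ basisSum r W' g
    basisSum-cong zero    eq h = h []
    basisSum-cong (suc r) eq h = S-cong (allFin n) λ t → cong₂ _*_ (out-cong eq t)
      (cong (x t *_) (basisSum-cong r (⊹-cong eq (V t)) (λ T → h (t ∷ T))))

    out-mono : ∀ {W : Subset k} {t a b} → (W (V t) ≡ false → a ≤ b) → out W t * a ≤ out W t * b
    out-mono {W} {t} h with W (V t)
    ... | true  = z≤n
    ... | false = *-monoʳ-≤ 1 (h refl)

    basisSum-mono : ∀ r {W : Subset k} {f g} → (∀ T → Indep W T → f T ≤ g T) →
      basisSum r W f ≤ basisSum r W g
    basisSum-mono zero    h = h [] tt
    basisSum-mono (suc r) {W} h = S-mono (allFin n) λ t → out-mono {W} {t} λ t∉W →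
      *-monoʳ-≤ (x t) (basisSum-mono r λ T ind → h (t ∷ T) (t∉W , ind))

    basisSum-*ˡ : ∀ r (W : Subset k) c f → basisSum r W (λ T → c * f T) ≡ c * basisSum r W f
    basisSum-*ˡ zero    W c f = refl
    basisSum-*ˡ (suc r) W c f = trans (S-cong (allFin n) λ t → trans
        (cong (λ z → out W t * (x t * z)) (basisSum-*ˡ r (W ⊹ V t) c _))
        (pull (out W t) (x t) c _))
      (S-*ˡ (allFin n) c _)
      where
      pull : ∀ a b c d → a * (b * (c * d)) ≡ c * (a * (b * d))
      pull = solve-∀

    basisSum-+ : ∀ r (W : Subset k) f g →
      basisSum r W (λ T → f T + g T) ≡ basisSum r W f + basisSum r W g
    basisSum-+ zero    W f g = refl
    basisSum-+ (suc r) W f g = trans (S-cong (allFin n) λ t → trans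
        (cong (λ z → out W t * (x t * z)) (basisSum-+ r (W ⊹ V t) _ _))
        (distr (out W t) (x t) _ _))
      (S-+ (allFin n) _ _)
      where
      distr : ∀ a b c d → a * (b * (c + d)) ≡ a * (b * c) + a * (b * d)
      distr = solve-∀

    -- Moving the first column of a tuple to the last place.
    basisSum-rotate : ∀ r (W : Subset k) (h : Fin n → ℕ) f →
      Σᶜ (λ t → out W t * (h t * basisSum r (W ⊹ V t) f))
        ≡ basisSum r W (λ T → f T * Σᶜ (λ t → out (span W T) t * h t))
    basisSum-rotate zero W h f = trans (S-cong (allFin n) λ t → shuffle (out W t) (h t) (f []))
      (S-*ˡ (allFin n) (f []) _)
      where
      shuffle : ∀ a b c → a * (b * c) ≡ c * (a * b)
      shuffle = solve-∀
    basisSum-rotate (suc r) W h f = begin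
      Σᶜ (λ t → out W t * (h t * Σᶜ (λ s → out (W ⊹ V t) s * (x s * B t s))))
        ≡⟨ S-cong (allFin n) (λ t → push (out W t) (h t) _) ⟩
      Σᶜ (λ t → Σᶜ (λ s → out W t * (h t * (out (W ⊹ V t) s * (x s * B t s)))))
        ≡⟨ S-swap (allFin n) (allFin n) _ ⟩
      Σᶜ (λ s → Σᶜ (λ t → out W t * (h t * (out (W ⊹ V t) s * (x s * B t s)))))
        ≡⟨ S-cong (allFin n) (λ s → S-cong (allFin n) (λ t → exchange s t)) ⟩
      Σᶜ (λ s → Σᶜ (λ t → out W s * (x s * (out (W ⊹ V s) t * (h t * B' s t)))))
        ≡⟨ S-cong (allFin n) (λ s → push (out W s) (x s) _) ⟨
      Σᶜ (λ s → out W s * (x s * Σᶜ (λ t → out (W ⊹ V s) t * (h t * B' s t))))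
        ≡⟨ S-cong (allFin n) (λ s → cong (λ z → out W s * (x s * z))
             (basisSum-rotate r (W ⊹ V s) h (λ T → f (s ∷ T)))) ⟩
      basisSum (suc r) W (λ T → f T * Σᶜ (λ t → out (span W T) t * h t)) ∎
      where
      open ≡-Reasoning
      B B' : Fin n → Fin n → ℕ
      B t s = basisSum r (W ⊹ V t ⊹ V s) (λ T → f (s ∷ T))
      B' s t = basisSum r (W ⊹ V s ⊹ V t) (λ T → f (s ∷ T))
      push : ∀ a b (g : Fin n → ℕ) → a * (b * Σᶜ g) ≡ Σᶜ (λ t → a * (b * g t))
      push a b g = sym (trans (S-*ˡ (allFin n) a _) (cong (a *_) (S-*ˡ (allFin n) b g)))
      left : ∀ a b c d e → a * (b * (c * (d * e))) ≡ (a * c) * (d * (b * e))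
      left = solve-∀
      right : ∀ a b c d e → (a * c) * (d * (b * e)) ≡ a * (d * (c * (b * e)))
      right = solve-∀
      exchange : ∀ s t → out W t * (h t * (out (W ⊹ V t) s * (x s * B t s)))
                       ≡ out W s * (x s * (out (W ⊹ V s) t * (h t * B' s t)))
      exchange s t = trans (left (out W t) (h t) _ (x s) (B t s)) (trans
        (cong₂ (λ o z → o * (x s * (h t * z))) (out-exchange W s t)
          (basisSum-cong r (⊹-comm W (V t) (V s)) (λ _ → refl)))
        (right (out W s) (h t) _ (x s) (B' s t)))

    -- The averaging argument in constructive form: if `f` exceeds `g` on every independent tuple,
    -- it does so by at least one, and the weighted sums then differ by at least the total weight.
    basisSum-search : ∀ r (W : Subset k) f g →
      (∃[ T ] (Indep W T × f T ≤ g T)) ⊎ (basisSum r W g + basisSum r W (λ _ → 1) ≤ basisSum r W f)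
    basisSum-search zero W f g with f [] ≤? g []
    ... | yes p = inj₁ ([] , tt , p)
    ... | no ¬p = inj₂ (≤-trans (≤-reflexive (+-comm (g []) 1)) (≰⇒> ¬p))
    basisSum-search (suc r) W f g = finish (search (allFin n))
      where
      G H K : Fin n → ℕ
      G t = out W t * (x t * basisSum r (W ⊹ V t) (λ T → g (t ∷ T)))
      H t = out W t * (x t * basisSum r (W ⊹ V t) (λ _ → 1))
      K t = out W t * (x t * basisSum r (W ⊹ V t) (λ T → f (t ∷ T)))
      Found : Set
      Found = ∃[ T ] (Indep W T × f T ≤ g T)
      distr : ∀ a b c d → a * (b * c) + a * (b * d) ≡ a * (b * (c + d))
      distr = solve-∀
      single : ∀ t → Found ⊎ (G t + H t ≤ K t)
      single t with W (V t) in eq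
      ... | true  = inj₂ z≤n
      ... | false with basisSum-search r (W ⊹ V t) (λ T → f (t ∷ T)) (λ T → g (t ∷ T))
      ...   | inj₁ (T , ind , p) = inj₁ (t ∷ T , (eq , ind) , p)
      ...   | inj₂ q = inj₂ (≤-trans (≤-reflexive (distr 1 (x t) _ _))
                         (*-monoʳ-≤ 1 (*-monoʳ-≤ (x t) q)))
      search : ∀ js → Found ⊎ (S js (λ t → G t + H t) ≤ S js K)
      search []       = inj₂ z≤n
      search (j ∷ js) with single j | search js
      ... | inj₁ p | _      = inj₁ p
      ... | inj₂ _ | inj₁ p = inj₁ p
      ... | inj₂ p | inj₂ q = inj₂ (+-mono-≤ p q)
      finish : Found ⊎ (Σᶜ (λ t → G t + H t) ≤ Σᶜ K) → Found ⊎ (Σᶜ G + Σᶜ H ≤ Σᶜ K)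
      finish (inj₁ p) = inj₁ p
      finish (inj₂ q) = inj₂ (subst (_≤ Σᶜ K) (S-+ (allFin n) G H) q)

-- Numbers of the form 2ʳ - 1

suc-mersenne : ∀ r → suc (2 ^ r ∸ 1) ≡ 2 ^ r
suc-mersenne r = m+[n∸m]≡n (m^n>0 2 r)

mersenne-suc : ∀ r → 2 ^ suc r ∸ 1 ≡ suc (2 * (2 ^ r ∸ 1))
mersenne-suc r = trans (cong (λ z → 2 * z ∸ 1) (sym (suc-mersenne r))) (cong (_∸ 1) (expand (2 ^ r ∸ 1)))
  where
  expand : ∀ a → 2 * suc a ≡ suc (suc (2 * a))
  expand = solve-∀

-- Weighted sampling of bases

-- By `bal` the weight `x j` plays the role of D / e j, without division.
module Sampling {k n : ℕ} (V : Fin n → Vec Bool k) (x e : Fin n → ℕ) (D : ℕ)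
                (bal : ∀ j → x j * e j ≡ D) where

  open Columns V
  open Weighted x

  E : Subset k → ℕ
  E W = Σᶜ (λ j → out W j * e j)

  inCoset : Subset k → Vec Bool k → Fin n → ℕ
  inCoset W v j = bit (W (V j ⊞ v))

  cosetSum : (Fin n → ℕ) → Subset k → Vec Bool k → ℕ
  cosetSum f W v = Σᶜ (λ j → inCoset W v j * f j)

  cosetSum-invariant : ∀ f {W u v} → IsSubspace W → W (u ⊞ v) ≡ true → cosetSum f W u ≡ cosetSum f W v
  cosetSum-invariant f {W} {u} {v} sub p = S-cong (allFin n) λ j → cong (λ b → bit b * f j)
    (trans (cong W (sym (regroup (V j)))) (shift sub (V j ⊞ v) p))
    where
    regroup : ∀ z → z ⊞ v ⊞ (u ⊞ v) ≡ z ⊞ u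
    regroup z = trans (sym (⊞-assoc (z ⊞ v) u v))
      (trans (⊞-rightComm (z ⊞ v) u v) (cong (_⊞ u) (⊞-cancelʳ z v)))

  -- A column outside `W` lies either in the coset of `t` or outside `W ⊹ t`, and never both.
  E-⊹ : ∀ {W t} → IsSubspace W → W t ≡ false → cosetSum e W t + E (W ⊹ t) ≡ E W
  E-⊹ {W} {t} sub t∉W = trans (sym (S-+ (allFin n) _ _)) (S-cong (allFin n) split)
    where
    split : ∀ j → inCoset W t j * e j + out (W ⊹ t) j * e j ≡ out W j * e j
    split j with W (V j) in eq | W (V j ⊞ t) in eq'
    ... | true  | true  = contradiction t∉W (true≢false (trans (sym (shift⁻ sub eq')) eq))
    ... | true  | false = refl
    ... | false | true  = +-identityʳ _
    ... | false | false = refl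

  -- The two terms on the right have product D² by `bal`, so this is the inequality of arithmetic
  -- and geometric means, in the shape that `weighted-cauchy` expects.
  pairwise : ∀ u w → 2 * (D * (1 * 1)) ≤ x u * e w + x w * e u
  pairwise u w = subst (λ d → 2 * d ≤ x u * e w + x w * e u) (sym (*-identityʳ D))
    (2D≤p+q {x u * e w} {x w * e u} {D} (trans (cross (x u) (e w) (x w) (e u)) (cong₂ _*_ (bal u) (bal w))))
    where
    cross : ∀ a b c d → a * b * (c * d) ≡ a * d * (c * b)
    cross = solve-∀

  -- Cauchy-Schwarz within one coset: the square of its number of columns is weighed against its
  -- total weight times its total error.
  coset-cauchy : ∀ W v → D * (cosetSum (λ _ → 1) W v * cosetSum (λ _ → 1) W v)
    ≤ cosetSum x W v * cosetSum e W v
  coset-cauchy W v = weighted-cauchy (allFin n) D (inCoset W v) (λ _ → 1) x e pairwise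

  -- Cauchy-Schwarz over the cosets outside a hyperplane

  module Complement {W H Y : Subset k} (subW : IsSubspace W) (subH : IsSubspace H)
           (W⊆H : W ⊆ H) (H⊆Y : H ⊆ Y) (subY : IsSubspace Y) (V∈Y : ∀ j → Y (V j) ≡ true) where

    inDiff : Vec Bool k → ℕ
    inDiff v = bit (Y v ∧ not (H v))

    size-diff : size Y ≡ size H + S (allVec k) inDiff
    size-diff = trans (S-cong (allVec k) split) (S-+ (allVec k) _ _)
      where
      split : ∀ v → bit (Y v) ≡ bit (H v) + inDiff v
      split v with H v in eq
      ... | true  rewrite H⊆Y v eq = refl
      ... | false with Y v
      ...   | true  = refl
      ...   | false = refl

    -- Summing over all vectors avoids the choice of coset representatives: each column outside `H`
    -- is met once for every vector of its coset, which gives the factor `size W`.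
    sum-over-cosets : (g : Vec Bool k → ℕ) → (∀ {u v} → W (u ⊞ v) ≡ true → g u ≡ g v) →
      (f : Fin n → ℕ) →
      S (allVec k) (λ v → inDiff v * (g v * cosetSum f W v))
        ≡ size W * Σᶜ (λ j → out H j * (f j * g (V j)))
    sum-over-cosets g inv f = begin
      S (allVec k) (λ v → inDiff v * (g v * cosetSum f W v))
        ≡⟨ S-cong (allVec k) (λ v → push (inDiff v) (g v) _) ⟩
      S (allVec k) (λ v → Σᶜ (λ j → inDiff v * (g v * (inCoset W v j * f j))))
        ≡⟨ S-swap (allVec k) (allFin n) _ ⟩
      Σᶜ (λ j → S (allVec k) (λ v → inDiff v * (g v * (inCoset W v j * f j))))
        ≡⟨ S-cong (allFin n) (λ j → trans (S-cong (allVec k) (λ v → move j v))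
             (trans (S-*ʳ (allVec k) _ _) (cong (_* const j) (coset-size j)))) ⟩
      Σᶜ (λ j → size W * const j)
        ≡⟨ S-*ˡ (allFin n) (size W) _ ⟩
      size W * Σᶜ const ∎
      where
      open ≡-Reasoning
      const : Fin n → ℕ
      const j = out H j * (f j * g (V j))
      push : ∀ a b (h : Fin n → ℕ) → a * (b * Σᶜ h) ≡ Σᶜ (λ t → a * (b * h t))
      push a b h = sym (trans (S-*ˡ (allFin n) a _) (cong (a *_) (S-*ˡ (allFin n) b h)))
      coset-size : ∀ j → S (allVec k) (λ v → inCoset W v j) ≡ size W
      coset-size j = trans (S-cong (allVec k) (λ v → cong (bit ∘ W) (⊞-comm (V j) v)))
        (S-translate k (V j) (λ v → bit (W v)))
      swap : ∀ a b c → a * (b * (1 * c)) ≡ 1 * (a * (c * b))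
      swap = solve-∀
      vanish : ∀ a b → a * (b * 0) ≡ 0
      vanish a b = trans (cong (a *_) (*-zeroʳ b)) (*-zeroʳ a)
      move : ∀ j v → inDiff v * (g v * (inCoset W v j * f j)) ≡ inCoset W v j * const j
      move j v with W (V j ⊞ v) in eq
      ... | false = vanish (inDiff v) (g v)
      ... | true  = trans (cong₂ (λ a b → a * (b * (1 * f j))) same (sym (inv eq)))
                      (swap (out H j) (g (V j)) (f j))
        where
        V+v∈H = W⊆H _ eq
        same : inDiff v ≡ out H j
        same = cong₂ (λ a b → bit (a ∧ not b))
          (trans (sym (shift⁻ subY (H⊆Y _ V+v∈H))) (V∈Y j)) (sym (shift⁻ subH V+v∈H))

    -- Cauchy–Schwarz over the 2ᵐ cosets of W that make up Y ∖ H, H being a hyperplane of Y.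
    hyperplane-cauchy : ∀ m → size H ≡ size W * 2 ^ m → size Y ≡ 2 * size H →
      D * (N H * N H) ≤ 2 ^ m * Σᶜ (λ j → out H j * (x j * cosetSum e W (V j)))
    -- Every sum over vectors carries a factor w from repeated cosets, so the inequality is proved
    -- multiplied by w² and then divided.
    hyperplane-cauchy m sizeH sizeY = *-cancelˡ-≤ (w * w) {{>-nonZero (*-mono-≤ w>0 w>0)}} (begin
      w * w * (D * (N H * N H))
        ≡⟨ into w D (N H) ⟩
      D * (w * N H * (w * N H))
        ≡⟨ cong (λ z → D * (z * z)) count ⟨
      D * (S (allVec k) (λ v → inDiff v * a v) * S (allVec k) (λ v → inDiff v * a v))
        ≤⟨ weighted-cauchy (allVec k) D inDiff a (λ _ → 1) xe pair ⟩
      S (allVec k) (λ v → inDiff v * 1) * S (allVec k) (λ v → inDiff v * xe v)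
        ≡⟨ cong₂ _*_ (S-cong (allVec k) (λ v → *-identityʳ (inDiff v)))
             (sum-over-cosets (cosetSum e W) (cosetSum-invariant e subW) x) ⟩
      S (allVec k) inDiff * (w * G)
        ≡⟨ cong (_* (w * G)) size-inDiff ⟩
      w * 2 ^ m * (w * G)
        ≡⟨ out-of w (2 ^ m) G ⟩
      w * w * (2 ^ m * G) ∎)
      where
      open ≤-Reasoning
      w G : ℕ
      w = size W
      G = Σᶜ (λ j → out H j * (x j * cosetSum e W (V j)))
      w>0 : 1 ≤ w
      w>0 = size>0 subW
      a xe : Vec Bool k → ℕ
      a = cosetSum (λ _ → 1) W
      xe v = cosetSum e W v * cosetSum x W v
      into : ∀ w D N → w * w * (D * (N * N)) ≡ D * (w * N * (w * N))
      into = solve-∀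
      out-of : ∀ w p G → w * p * (w * G) ≡ w * w * (p * G)
      out-of = solve-∀
      size-inDiff : S (allVec k) inDiff ≡ w * 2 ^ m
      size-inDiff = trans (+-cancelˡ-≡ (size H) _ _ (trans (sym size-diff)
        (trans sizeY (cong (size H +_) (+-identityʳ (size H)))))) sizeH
      count : S (allVec k) (λ v → inDiff v * a v) ≡ w * N H
      count = trans (S-cong (allVec k) (λ v → cong (inDiff v *_) (sym (*-identityˡ (a v)))))
        (trans (sum-over-cosets (λ _ → 1) (λ _ → refl) (λ _ → 1))
          (cong (w *_) (S-cong (allFin n) (λ j → *-identityʳ (out H j)))))
      -- The hypothesis of the outer Cauchy-Schwarz comes from the inner one in the two cosets,
      -- joined by 2ab ≤ a² + b².
      pair : ∀ u v → 2 * (D * (a u * a v)) ≤ 1 * xe v + 1 * xe u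
      pair u v = begin
        2 * (D * (a u * a v))                  ≡⟨ inside D (a u) (a v) ⟩
        D * (2 * (a u * a v))                  ≤⟨ *-monoʳ-≤ D (2ab≤a²+b² (a u) (a v)) ⟩
        D * (a u * a u + a v * a v)            ≡⟨ *-distribˡ-+ D _ _ ⟩
        D * (a u * a u) + D * (a v * a v)      ≤⟨ +-mono-≤ (coset-cauchy W u) (coset-cauchy W v) ⟩
        cosetSum x W u * cosetSum e W u + cosetSum x W v * cosetSum e W v
          ≡⟨ reorder (cosetSum x W u) _ (cosetSum x W v) _ ⟩
        1 * xe v + 1 * xe u                    ∎
        where
        inside : ∀ D a b → 2 * (D * (a * b)) ≡ D * (2 * (a * b))
        inside = solve-∀
        reorder : ∀ a b c d → a * b + c * d ≡ 1 * (d * c) + 1 * (b * a)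
        reorder = solve-∀

  -- Expected cost by induction on the corank

  module Ambient {Y : Subset k} (subY : IsSubspace Y) (V∈Y : ∀ j → Y (V j) ≡ true) where

    -- Codimension `r` in `Y`, expressed by counting vectors.
    record Corank (r : ℕ) (W : Subset k) : Set where
      field
        sub    : IsSubspace W
        ⊆Y     : W ⊆ Y
        size≡  : size Y ≡ size W * 2 ^ r

    open Corank

    Corank-⊹ : ∀ {r W t} → Corank (suc r) W → W (V t) ≡ false → Corank r (W ⊹ V t)
    Corank-⊹ {r} {W} {t} c t∉W = record
      { sub   = ⊹-subspace (sub c) (V t)
      ; ⊆Y    = ⊹-⊆ (sub c) subY (⊆Y c) (V∈Y t)
      ; size≡ = trans (size≡ c) (trans (assoc (size W) (2 ^ r))
                  (cong (_* 2 ^ r) (sym (size-⊹ (sub c) t∉W))))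
      }
      where
      assoc : ∀ a b → a * (2 * b) ≡ 2 * a * b
      assoc = solve-∀

    bases : ℕ → Subset k → ℕ
    bases r W = basisSum r W (λ _ → 1)

    -- The value at rank 0 is a dummy: it only occurs with the factor 2⁰ ∸ 1 = 0.
    hyperplaneSum : ℕ → Subset k → ℕ
    hyperplaneSum zero    W = 0
    hyperplaneSum (suc r) W = basisSum r W (λ T → N (span W T) * N (span W T))

    -- Unfolding over the first column is definitional for positive `r`; for `r` = 0 it would meet
    -- the dummy value, and the factor 2⁰ ∸ 1 removes that case.
    hyperplaneSum-suc : ∀ r W →
      (2 ^ r ∸ 1) * hyperplaneSum (suc r) W
        ≡ (2 ^ r ∸ 1) * Σᶜ (λ t → out W t * (x t * hyperplaneSum r (W ⊹ V t)))
    hyperplaneSum-suc zero    W = refl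
    hyperplaneSum-suc (suc r) W = refl

    -- The weighted sum over bases of the error carried by the coset of the first column, which is
    -- exactly what `E W` loses in the quotient by that column.
    cosetEnergy : ℕ → Subset k → ℕ
    cosetEnergy r W = Σᶜ (λ t → out W t * (x t * cosetSum e W (V t) * bases r (W ⊹ V t)))

    -- `hyperplane-cauchy` applies to the hyperplane spanned by each `r`-tuple. Its right side sums
    -- over one more column, which `basisSum-rotate` moves to the front.
    hyperplaneSum≤cosetEnergy : ∀ {r W} → Corank (suc r) W →
      D * hyperplaneSum (suc r) W ≤ 2 ^ r * cosetEnergy r W
    hyperplaneSum≤cosetEnergy {r} {W} c = begin
      D * basisSum r W (λ T → N (span W T) * N (span W T))
        ≡⟨ basisSum-*ˡ r W D _ ⟨
      basisSum r W (λ T → D * (N (span W T) * N (span W T)))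
        ≤⟨ basisSum-mono r bound ⟩
      basisSum r W (λ T → 2 ^ r * (1 * Σᶜ (λ t → out (span W T) t * (x t * cosetSum e W (V t)))))
        ≡⟨ basisSum-*ˡ r W (2 ^ r) _ ⟩
      2 ^ r * basisSum r W (λ T → 1 * Σᶜ (λ t → out (span W T) t * (x t * cosetSum e W (V t))))
        ≡⟨ cong (2 ^ r *_) (basisSum-rotate r W (λ t → x t * cosetSum e W (V t)) (λ _ → 1)) ⟨
      2 ^ r * cosetEnergy r W ∎
      where
      open ≤-Reasoning
      assoc : ∀ a b → a * (2 * b) ≡ 2 * (a * b)
      assoc = solve-∀
      bound : ∀ T → Indep W T → D * (N (span W T) * N (span W T))
        ≤ 2 ^ r * (1 * Σᶜ (λ t → out (span W T) t * (x t * cosetSum e W (V t))))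
      bound T ind = subst (λ z → D * (N (span W T) * N (span W T)) ≤ 2 ^ r * z) (sym (*-identityˡ _))
        (Complement.hyperplane-cauchy (sub c) (span-subspace (sub c) T) (⊆-span W T)
          (span-⊆ (sub c) subY (⊆Y c) V∈Y T) subY V∈Y r sizeH
          (trans (size≡ c) (trans (assoc (size W) (2 ^ r)) (cong (2 *_) (sym sizeH)))))
        where
        sizeH : size (span W T) ≡ size W * 2 ^ r
        sizeH = size-span (sub c) T ind

    -- Induction through 2ʳ⁺¹ - 1 = 1 + 2 (2ʳ - 1). The single copy of Q is bounded by
    -- `cosetEnergy`, the remaining ones by the induction hypothesis modulo the first column; `E-⊹`
    -- joins the two errors into `E W`.
    hyperplaneSum-bound : ∀ r {W} → Corank r W →
      2 * (D * ((2 ^ r ∸ 1) * hyperplaneSum r W)) ≤ 2 ^ r * (bases r W * E W)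
    hyperplaneSum-bound zero    c = ≤-trans (≤-reflexive (cong (2 *_) (*-zeroʳ D))) z≤n
    hyperplaneSum-bound (suc r) {W} c = begin
      2 * (D * ((2 ^ suc r ∸ 1) * Q))
        ≡⟨ cong (λ z → 2 * (D * (z * Q))) (mersenne-suc r) ⟩
      2 * (D * (suc (2 * a) * Q))
        ≡⟨ expand D a Q ⟩
      2 * (D * Q + 2 * (D * (a * Q)))
        ≡⟨ cong (λ z → 2 * (D * Q + 2 * (D * z))) (hyperplaneSum-suc r W) ⟩
      2 * (D * Q + 2 * (D * (a * Q')))
        ≤⟨ *-monoʳ-≤ 2 (+-mono-≤ (hyperplaneSum≤cosetEnergy c) step) ⟩
      2 * (2 ^ r * cosetEnergy r W + 2 ^ r * R)
        ≡⟨ factor (2 ^ r) _ _ ⟩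
      2 ^ suc r * (cosetEnergy r W + R)
        ≡⟨ cong (2 ^ suc r *_) combine ⟩
      2 ^ suc r * (bases (suc r) W * E W) ∎
      where
      open ≤-Reasoning
      a Q Q' R : ℕ
      a = 2 ^ r ∸ 1
      Q = hyperplaneSum (suc r) W
      Q' = Σᶜ (λ t → out W t * (x t * hyperplaneSum r (W ⊹ V t)))
      R = Σᶜ (λ t → out W t * (x t * (bases r (W ⊹ V t) * E (W ⊹ V t))))
      expand : ∀ D a Q → 2 * (D * (suc (2 * a) * Q)) ≡ 2 * (D * Q + 2 * (D * (a * Q)))
      expand = solve-∀
      factor : ∀ p b c → 2 * (p * b + p * c) ≡ 2 * p * (b + c)
      factor = solve-∀
      pull : ∀ c o y z → c * (o * (y * z)) ≡ o * (y * (c * z))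
      pull = solve-∀
      assoc : ∀ D a q → 2 * (D * (a * q)) ≡ 2 * D * a * q
      assoc = solve-∀
      step : 2 * (D * (a * Q')) ≤ 2 ^ r * R
      step = begin
        2 * (D * (a * Q'))
          ≡⟨ assoc D a Q' ⟩
        2 * D * a * Q'
          ≡⟨ S-*ˡ (allFin n) (2 * D * a) _ ⟨
        Σᶜ (λ t → 2 * D * a * (out W t * (x t * hyperplaneSum r (W ⊹ V t))))
          ≡⟨ S-cong (allFin n) (λ t → trans (pull (2 * D * a) (out W t) (x t) _)
               (cong (λ z → out W t * (x t * z)) (sym (assoc D a _)))) ⟩
        Σᶜ (λ t → out W t * (x t * (2 * (D * (a * hyperplaneSum r (W ⊹ V t))))))
          ≤⟨ S-mono (allFin n) (λ t → out-mono {W} {t} λ t∉W →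
               *-monoʳ-≤ (x t) (hyperplaneSum-bound r (Corank-⊹ {t = t} c t∉W))) ⟩
        Σᶜ (λ t → out W t * (x t * (2 ^ r * (bases r (W ⊹ V t) * E (W ⊹ V t)))))
          ≡⟨ S-cong (allFin n) (λ t → sym (pull (2 ^ r) (out W t) (x t) _)) ⟩
        Σᶜ (λ t → 2 ^ r * (out W t * (x t * (bases r (W ⊹ V t) * E (W ⊹ V t)))))
          ≡⟨ S-*ˡ (allFin n) (2 ^ r) _ ⟩
        2 ^ r * R ∎
      collect : ∀ o y g b h → o * (y * g * b) + o * (y * (b * h)) ≡ o * (y * (b * (g + h)))
      collect = solve-∀
      regroup : ∀ o y b h → o * (y * (b * h)) ≡ o * (y * b) * h
      regroup = solve-∀
      energies : ∀ t → out W t * (x t * (bases r (W ⊹ V t) * (cosetSum e W (V t) + E (W ⊹ V t))))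
                     ≡ out W t * (x t * (bases r (W ⊹ V t) * E W))
      energies t with W (V t) in eq
      ... | true  = refl
      ... | false = cong (λ z → 1 * (x t * (bases r (W ⊹ V t) * z))) (E-⊹ (sub c) eq)
      combine : cosetEnergy r W + R ≡ bases (suc r) W * E W
      combine = trans (sym (S-+ (allFin n) _ _)) (trans
        (S-cong (allFin n) (λ t → trans (collect (out W t) (x t) _ _ _)
          (trans (energies t) (regroup (out W t) (x t) _ _))))
        (S-*ʳ (allFin n) (E W) _))

    -- All `r` columns contribute equally. For the first one, weight times error is `D`, so after
    -- rotation the sum over it merely counts the columns outside the hyperplane spanned by the
    -- others; this supplies the second factor `N`.
    basisSum-cost : ∀ r W → basisSum r W (cost e W) ≡ r * (D * hyperplaneSum r W)
    basisSum-cost zero    W = refl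
    basisSum-cost (suc r) W = begin
      Σᶜ (λ t → out W t * (x t * basisSum r (W ⊹ V t) (λ T → e t * N (span W T) + cost e (W ⊹ V t) T)))
        ≡⟨ S-cong (allFin n) (λ t → trans
             (cong (λ z → out W t * (x t * z)) (trans
               (basisSum-+ r (W ⊹ V t) (λ T → e t * N (span W T)) (cost e (W ⊹ V t)))
               (cong₂ _+_ (basisSum-*ˡ r (W ⊹ V t) (e t) (λ T → N (span W T))) (basisSum-cost r (W ⊹ V t)))))
             (trans (distr (out W t) (x t) (e t) _ _ )
               (cong (λ z → out W t * (z * B t) + out W t * (x t * (r * (D * hyperplaneSum r (W ⊹ V t))))) (bal t)))) ⟩
      Σᶜ (λ t → out W t * (D * B t) + out W t * (x t * (r * (D * hyperplaneSum r (W ⊹ V t)))))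
        ≡⟨ S-+ (allFin n) _ _ ⟩
      Σᶜ (λ t → out W t * (D * B t)) + Σᶜ (λ t → out W t * (x t * (r * (D * hyperplaneSum r (W ⊹ V t)))))
        ≡⟨ cong₂ _+_ first (rest r) ⟩
      D * hyperplaneSum (suc r) W + r * (D * hyperplaneSum (suc r) W) ∎
      where
      open ≡-Reasoning
      B : Fin n → ℕ
      B t = basisSum r (W ⊹ V t) (λ T → N (span W T))
      distr : ∀ o y g b h → o * (y * (g * b + h)) ≡ o * (y * g * b) + o * (y * h)
      distr = solve-∀
      first : Σᶜ (λ t → out W t * (D * B t)) ≡ D * hyperplaneSum (suc r) W
      first = trans (basisSum-rotate r W (λ _ → D) (λ T → N (span W T))) (trans
        (basisSum-cong r (λ _ → refl) (λ T → trans
          (cong (N (span W T) *_) (S-*ʳ (allFin n) D (out (span W T))))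
          (shuffle (N (span W T)) D)))
        (basisSum-*ˡ r W D _))
        where
        shuffle : ∀ a d → a * (a * d) ≡ d * (a * a)
        shuffle = solve-∀
      pull : ∀ o y c d q → o * (y * (c * (d * q))) ≡ c * d * (o * (y * q))
      pull = solve-∀
      -- The case split lets `hyperplaneSum` unfold; at 0 its dummy value meets the factor 0.
      rest : ∀ r → Σᶜ (λ t → out W t * (x t * (r * (D * hyperplaneSum r (W ⊹ V t)))))
        ≡ r * (D * hyperplaneSum (suc r) W)
      rest zero    = trans (S-cong (allFin n) (λ t → pull (out W t) (x t) 0 D 0)) (S-zero (allFin n))
      rest (suc r) = trans (S-cong (allFin n) (λ t → pull (out W t) (x t) (suc r) D _))
        (trans (S-*ˡ (allFin n) (suc r * D) _) (*-assoc (suc r) D _))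

-- Existence of a cheap basis

∑-term : ∀ n (f : Fin n → ℕ) j → f j ≤ ∑ n f
∑-term (suc n) f zero    = m≤m+n (f zero) _
∑-term (suc n) f (suc j) = ≤-trans (∑-term n (f ∘ suc) j) (m≤n+m _ (f zero))

-- `D` is the product of all errors and `x j` the product of the others, which clears the
-- denominators of the sampling weights 1 / e j.
common-multiple : ∀ n (e : Fin n → ℕ) → (∀ j → 1 ≤ e j) →
  ∃[ D ] (1 ≤ D × Σ (Fin n → ℕ) λ x → ∀ j → 1 ≤ x j × x j * e j ≡ D)
common-multiple zero    e e>0 = 1 , ≤-refl , (λ ()) , λ ()
common-multiple (suc n) e e>0 with common-multiple n (e ∘ suc) (e>0 ∘ suc)
... | D , D>0 , x , bal = e zero * D , *-mono-≤ (e>0 zero) D>0 , x' , bal'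
  where
  x' : Fin (suc n) → ℕ
  x' zero    = D
  x' (suc j) = e zero * x j
  bal' : ∀ j → 1 ≤ x' j × x' j * e j ≡ e zero * D
  bal' zero    = D>0 , *-comm D (e zero)
  bal' (suc j) = *-mono-≤ (e>0 zero) (proj₁ (bal j)) ,
    trans (*-assoc (e zero) (x j) _) (cong (e zero *_) (proj₂ (bal j)))

module BasisChoice {k n : ℕ} (V : Fin n → Vec Bool k) where

  open Columns V

  -- The column space of `V` with its dimension; `minimal` expresses that the columns generate it.
  record Hull : Set where
    field
      rank    : ℕ
      Y       : Subset k
      sub     : IsSubspace Y
      V∈Y     : ∀ j → Y (V j) ≡ true
      minimal : ∀ {H} → IsSubspace H → (∀ j → H (V j) ≡ true) → Y ⊆ H
      size≡   : size Y ≡ 2 ^ rank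
      rank≤k  : rank ≤ k

  abstract
    -- Columns outside the current space are adjoined until none is left. Each one doubles the size,
    -- and `fuel` counts the dimensions still available.
    hull : Hull
    hull = grow k 0 isZero (+-identityʳ k) isZero-subspace (size-isZero k)
        (λ {H} subH _ v p → subst (λ u → H u ≡ true) (sym (isZero⇒≡𝟎 v p)) (0∈ subH))
      where
      grow : ∀ fuel m W → fuel + m ≡ k → IsSubspace W → size W ≡ 2 ^ m →
        (∀ {H} → IsSubspace H → (∀ j → H (V j) ≡ true) → W ⊆ H) → Hull
      grow fuel m W fuel+m≡k sub size≡ minimal with any? (λ j → W (V j) ≟ false)
      ... | no none = record
        { rank = m ; Y = W ; sub = sub ; V∈Y = λ j → ¬-not (λ p → none (j , p))
        ; minimal = minimal ; size≡ = size≡ ; rank≤k = subst (m ≤_) fuel+m≡k (m≤n+m m fuel) }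
      -- Without fuel `m` equals `k`, and another doubling would exceed the 2ᵏ vectors available.
      grow zero m W refl sub size≡ minimal | yes (j , j∉W) =
        contradiction (subst (_≤ 2 ^ m) size-next (size≤2^k (W ⊹ V j)))
          (<⇒≱ (^-monoʳ-< 2 (s≤s (s≤s z≤n)) (n<1+n m)))
        where
        size-next : size (W ⊹ V j) ≡ 2 ^ suc m
        size-next = trans (size-⊹ sub j∉W) (cong (2 *_) size≡)
      grow (suc fuel) m W fuel+m≡k sub size≡ minimal | yes (j , j∉W) =
        grow fuel (suc m) (W ⊹ V j) (trans (+-suc fuel m) fuel+m≡k) (⊹-subspace sub (V j))
          (trans (size-⊹ sub j∉W) (cong (2 *_) size≡))
          (λ subH V∈H → ⊹-⊆ sub subH (minimal subH V∈H) (V∈H j))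

  open Hull hull public

  rootCorank : ∀ x e D bal → Sampling.Ambient.Corank {k} {n} V x e D bal sub V∈Y rank isZero
  rootCorank x e D bal = record
    { sub   = isZero-subspace
    ; ⊆Y    = λ v p → subst (λ u → Y u ≡ true) (sym (isZero⇒≡𝟎 v p)) (0∈ sub)
    ; size≡ = trans size≡ (sym (trans (cong (_* 2 ^ rank) (size-isZero k)) (*-identityˡ _)))
    }

  module _ (x e : Fin n → ℕ) (D : ℕ) (bal : ∀ j → 1 ≤ x j × x j * e j ≡ D) where

    open Weighted x
    open Sampling V x e D (proj₂ ∘ bal)
    open Ambient sub V∈Y
    open Corank using () renaming (sub to subW; size≡ to sizeW)

    -- At positive corank some column lies outside `W`, for otherwise `minimal` would put `Y` inside
    -- `W`. Its summand is positive.
    bases>0 : ∀ r {W} → Corank r W → 1 ≤ bases r W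
    bases>0 zero    c = ≤-refl
    bases>0 (suc r) {W} c with any? (λ j → W (V j) ≟ false)
    ... | no none = contradiction (begin-strict
      size W                 <⟨ m<m+n (size W) (size>0 (subW c)) ⟩
      size W + size W        ≡⟨ double (size W) ⟩
      size W * 2             ≤⟨ *-monoʳ-≤ (size W) (m≤m*n 2 (2 ^ r) {{>-nonZero (m^n>0 2 r)}}) ⟩
      size W * 2 ^ suc r     ≡⟨ sizeW c ⟨
      size Y                 ≤⟨ size-mono (minimal (subW c) (λ j → ¬-not (λ p → none (j , p)))) ⟩
      size W                 ∎) (<-irrefl refl)
      where
      open ≤-Reasoning
      double : ∀ a → a + a ≡ a * 2
      double = solve-∀
    ... | yes (j , j∉W) = begin
      1                                        ≤⟨ *-mono-≤ (≤-reflexive (cong (bit ∘ not) (sym j∉W)))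
                                                    (*-mono-≤ (proj₁ (bal j)) (bases>0 r (Corank-⊹ {t = j} c j∉W))) ⟩
      out W j * (x j * bases r (W ⊹ V j))      ≤⟨ ∑-term n (λ t → out W t * (x t * bases r (W ⊹ V t))) j ⟩
      ∑ n (λ t → out W t * (x t * bases r (W ⊹ V t)))  ≡⟨ ∑≡S n _ ⟩
      bases (suc r) W                          ∎
      where open ≤-Reasoning

    -- By `basisSum-cost` and `hyperplaneSum-bound` the weighted sum of the scaled costs is at most
    -- the right side times the total weight. If no tuple met the bound, the sum would exceed this
    -- by the total weight, which is positive.
    cheapBasis-positive : ∃[ T ] (Indep isZero T × 2 * (2 ^ rank ∸ 1) * cost e isZero T ≤ rank * (2 ^ rank * E isZero))
    cheapBasis-positive with basisSum-search rank isZero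
      (λ T → 2 * (2 ^ rank ∸ 1) * cost e isZero T) (λ _ → rank * (2 ^ rank * E isZero))
    ... | inj₁ found = found
    ... | inj₂ tooBig = contradiction (begin-strict
      bs β                                  <⟨ m<m+n (bs β) (bases>0 rank root) ⟩
      bs β + bases rank isZero              ≤⟨ tooBig ⟩
      basisSum rank isZero (λ T → 2 * a * cost e isZero T)
        ≡⟨ trans (basisSum-*ˡ rank isZero (2 * a) _) (cong (2 * a *_) (basisSum-cost rank isZero)) ⟩
      2 * a * (rank * (D * Q))              ≡⟨ regroup a rank D Q ⟩
      rank * (2 * (D * (a * Q)))            ≤⟨ *-monoʳ-≤ rank (hyperplaneSum-bound rank root) ⟩
      rank * (2 ^ rank * (bases rank isZero * E isZero))
        ≡⟨ pull rank (2 ^ rank) (bases rank isZero) (E isZero) ⟩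
      β * bases rank isZero                 ≡⟨ basisSum-*ˡ rank isZero β (λ _ → 1) ⟨
      bs (β * 1)                            ≡⟨ cong bs (*-identityʳ β) ⟩
      bs β ∎) (<-irrefl refl)
      where
      open ≤-Reasoning
      root : Corank rank isZero
      root = rootCorank x e D (proj₂ ∘ bal)
      a β Q : ℕ
      a = 2 ^ rank ∸ 1
      β = rank * (2 ^ rank * E isZero)
      Q = hyperplaneSum rank isZero
      bs : ℕ → ℕ
      bs c = basisSum rank isZero (λ _ → c)
      regroup : ∀ a r D Q → 2 * a * (r * (D * Q)) ≡ r * (2 * (D * (a * Q)))
      regroup = solve-∀
      pull : ∀ r p b E → r * (p * (b * E)) ≡ r * (p * E) * b
      pull = solve-∀

  cost-scale : ∀ {r} M (e e' : Fin n → ℕ) → (∀ j → M * e j ≤ e' j) → ∀ W (T : Vec (Fin n) r) →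
    M * cost e W T ≤ cost e' W T
  cost-scale M e e' h W []      = ≤-reflexive (*-zeroʳ M)
  cost-scale M e e' h W (t ∷ T) = ≤-trans (≤-reflexive (distr M (e t) _ _))
    (+-mono-≤ (*-monoˡ-≤ _ (h t)) (cost-scale M e e' h (W ⊹ V t) T))
    where
    distr : ∀ M a b c → M * (a * b + c) ≡ M * a * b + M * c
    distr = solve-∀

  -- Sampling needs positive errors, so it is applied to M e + 1 with M beyond the resolution of the bound.
  cheapBasis : (e : Fin n → ℕ) →
    ∃[ T ] (Indep isZero T × 2 * (2 ^ rank ∸ 1) * cost e isZero T ≤ rank * (2 ^ rank * Σᶜ e))
  cheapBasis e = from (common-multiple n e' (λ _ → s≤s z≤n))
    where
    B c M a : ℕ
    B = rank * 2 ^ rank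
    c = Σᶜ (λ _ → 1)
    -- The added ones raise the bound by at most B * c, which is less than M and so disappears on
    -- division by M.
    M = suc (B * c)
    a = 2 ^ rank ∸ 1
    e' : Fin n → ℕ
    e' j = suc (M * e j)
    Σe' : Σᶜ e' ≡ c + M * Σᶜ e
    Σe' = trans (S-+ (allFin n) (λ _ → 1) _) (cong (c +_) (S-*ˡ (allFin n) M e))
    bit≤1 : ∀ b → bit b ≤ 1
    bit≤1 true  = ≤-refl
    bit≤1 false = z≤n
    from : _ → _
    from (D , _ , x , bal) with cheapBasis-positive x e' D bal
    ... | T , ind , bound = T , ind , s≤s⁻¹ (*-cancelˡ-< M _ _ (begin-strict
      M * (2 * a * cost e isZero T)      ≡⟨ comm M (2 * a) _ ⟩
      2 * a * (M * cost e isZero T)      ≤⟨ *-monoʳ-≤ (2 * a) (cost-scale M e e' (λ _ → n≤1+n _) isZero T) ⟩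
      2 * a * cost e' isZero T           ≤⟨ bound ⟩
      rank * (2 ^ rank * Σᶜ (λ j → out isZero j * e' j))
        ≤⟨ *-monoʳ-≤ rank (*-monoʳ-≤ (2 ^ rank) (S-mono (allFin n) λ j →
             ≤-trans (*-monoˡ-≤ (e' j) (bit≤1 (not (isZero (V j))))) (≤-reflexive (*-identityˡ (e' j))))) ⟩
      rank * (2 ^ rank * Σᶜ e')          ≡⟨ cong (λ z → rank * (2 ^ rank * z)) Σe' ⟩
      rank * (2 ^ rank * (c + M * Σᶜ e)) ≡⟨ expand rank (2 ^ rank) c M (Σᶜ e) ⟩
      B * c + M * (rank * (2 ^ rank * Σᶜ e)) <⟨ n<1+n _ ⟩
      M + M * (rank * (2 ^ rank * Σᶜ e)) ≡⟨ *-suc M _ ⟨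
      M * suc (rank * (2 ^ rank * Σᶜ e)) ∎))
      where
      open ≤-Reasoning
      comm : ∀ M a b → M * (a * b) ≡ a * (M * b)
      comm = solve-∀
      expand : ∀ r p c M s → r * (p * (c + M * s)) ≡ r * p * c + M * (r * (p * s))
      expand = solve-∀

  -- The span lies in `Y` and has the same number of elements, 2 to the power `rank`.
  Indep⇒spanning : (T : Vec (Fin n) rank) → Indep isZero T → ∀ j → span isZero T (V j) ≡ true
  Indep⇒spanning T ind j = ⊆-size-antisym (span-subspace isZero-subspace T) sub
    (span-⊆ isZero-subspace sub zero⊆Y V∈Y T)
    (≤-reflexive (trans size≡ (sym (trans (size-span isZero-subspace T ind)
      (trans (cong (_* 2 ^ rank) (size-isZero k)) (*-identityˡ _))))))
    (V j) (V∈Y j)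
    where
    zero⊆Y : isZero ⊆ Y
    zero⊆Y v p = subst (λ u → Y u ≡ true) (sym (isZero⇒≡𝟎 v p)) (0∈ sub)

  -- Representing columns by a basis

  scale : Bool → Vec Bool k → Vec Bool k
  scale true  v = v
  scale false v = 𝟎

  comb : ∀ {r} → Vec Bool r → Vec (Fin n) r → Vec Bool k
  comb []       []      = 𝟎
  comb (b ∷ bs) (t ∷ T) = scale b (V t) ⊞ comb bs T

  used : ∀ {r} → (Fin n → ℕ) → Vec Bool r → Vec (Fin n) r → ℕ
  used e []       []      = 0
  used e (b ∷ bs) (t ∷ T) = bit b * e t + used e bs T

  -- The share of a single vector in `cost`: the count `N` there is this indicator summed over all
  -- columns.
  vectorCost : ∀ {r} → (Fin n → ℕ) → Subset k → Vec (Fin n) r → Vec Bool k → ℕ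
  vectorCost e W []      v = 0
  vectorCost e W (t ∷ T) v = e t * bit (not (span W T v)) + vectorCost e (W ⊹ V t) T v

  Σ-vectorCost : ∀ {r} e W (T : Vec (Fin n) r) → Σᶜ (λ j → vectorCost e W T (V j)) ≡ cost e W T
  Σ-vectorCost e W []      = S-zero (allFin n)
  Σ-vectorCost e W (t ∷ T) = trans (S-+ (allFin n) _ _)
    (cong₂ _+_ (S-*ˡ (allFin n) (e t) _) (Σ-vectorCost e (W ⊹ V t) T))

  comb∈span : ∀ {r W} → IsSubspace W → (bs : Vec Bool r) (T : Vec (Fin n) r) →
    span W T (comb bs T) ≡ true
  comb∈span sub []       []      = 0∈ sub
  comb∈span {W = W} sub (b ∷ bs) (t ∷ T) = +∈ (span-subspace sub' T) (scaled b) (comb∈span sub' bs T)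
    where
    sub' = ⊹-subspace sub (V t)
    scaled : ∀ b → span (W ⊹ V t) T (scale b (V t)) ≡ true
    scaled true  = ⊆-span (W ⊹ V t) T (V t) (t∈⊹ sub (V t))
    scaled false = 0∈ (span-subspace sub' T)

  -- The coefficients are found from the last column backwards: the tail represents `v` modulo
  -- `W ⊹ V t`, and the remainder decides the coefficient of `t`. If it is 1, then `v` is outside
  -- the span of `W` and the tail, where `vectorCost` charges `e t`.
  represent : ∀ {r W} → IsSubspace W → (e : Fin n → ℕ) (T : Vec (Fin n) r) → Indep W T → ∀ v →
    span W T v ≡ true → ∃[ bs ] (W (v ⊞ comb bs T) ≡ true × used e bs T ≤ vectorCost e W T v)
  represent {W = W} sub e []      _   v v∈ = [] , subst (λ u → W u ≡ true) (sym (⊞-identityʳ v)) v∈ , z≤n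
  represent {W = W} sub e (t ∷ T) ind v v∈
    with represent (⊹-subspace sub (V t)) e T (proj₂ ind) v v∈
  ... | bs , rest∈ , bound with ∨-true (W (v ⊞ comb bs T)) rest∈
  ... | inj₁ p = false ∷ bs
      , subst (λ u → W (v ⊞ u) ≡ true) (sym (trans (⊞-comm 𝟎 _) (⊞-identityʳ _))) p
      , ≤-trans bound (m≤n+m _ _)
  ... | inj₂ p = true ∷ bs
      , subst (λ u → W u ≡ true) (trans (⊞-assoc v _ _) (cong (v ⊞_) (⊞-comm _ (V t)))) p
      , +-mono-≤ (≤-reflexive (trans (*-comm 1 (e t)) (cong (λ b → e t * bit (not b)) (sym v∉)))) bound
    where
    subH = span-subspace sub T
    -- Modulo `span W T` the vector `v` is congruent to `V t`, which independence keeps outside.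
    v∉ : span W T v ≡ false
    v∉ = trans (sym (shift subH v (comb∈span sub bs T)))
      (trans (shift⁻ subH (⊆-span W T _ p)) (Indep⇒head∉span T ind))

-- Passing from the rank to k

r<2^r : ∀ r → r < 2 ^ r
r<2^r zero    = s≤s z≤n
r<2^r (suc r) = ≤-trans (+-mono-≤ (m^n>0 2 r) (r<2^r r))
  (≤-reflexive (cong (2 ^ r +_) (sym (+-identityʳ (2 ^ r)))))

-- At `r` = 0 the inequality reads 0 ≤ 0 and does not restrict `X`, so that case has its own clause.
RatioBound : ℕ → ℕ → ℕ → Set
RatioBound X E r = (r ≡ 0 → X ≡ 0) × 2 * (2 ^ r ∸ 1) * X ≤ r * (2 ^ r * E)

-- The ratio r 2ʳ / (2 (2ʳ - 1)) does not decrease for positive `r`: cross multiplication reduces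
-- this to r ≤ 2 (2ʳ - 1).
RatioBound-suc : ∀ {X E} r → RatioBound X E r → RatioBound X E (suc r)
RatioBound-suc zero (X≡0 , _) rewrite X≡0 refl = (λ ()) , z≤n
RatioBound-suc {X} {E} r@(suc r') (_ , h) = (λ ()) , *-cancelˡ-≤ a {{>-nonZero a>0}} (begin
  a * (2 * (2 ^ suc r ∸ 1) * X)        ≡⟨ cong (λ z → a * (2 * z * X)) (mersenne-suc r) ⟩
  a * (2 * suc (2 * a) * X)            ≡⟨ left a X ⟩
  suc (2 * a) * (2 * a * X)            ≤⟨ *-monoʳ-≤ (suc (2 * a)) h ⟩
  suc (2 * a) * (r * (2 ^ r * E))      ≡⟨ middle a r (2 ^ r * E) ⟩
  (2 * a * r + r) * (2 ^ r * E)        ≤⟨ *-monoˡ-≤ (2 ^ r * E) (+-monoʳ-≤ (2 * a * r) r≤2a) ⟩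
  (2 * a * r + 2 * a) * (2 ^ r * E)    ≡⟨ right a r (2 ^ r) E ⟩
  a * (suc r * (2 ^ suc r * E))        ∎)
  where
  open ≤-Reasoning
  a : ℕ
  a = 2 ^ r ∸ 1
  r≤a : r ≤ a
  r≤a = ∸-monoˡ-≤ 1 (r<2^r r)
  a>0 : 0 < a
  a>0 = ≤-trans (s≤s z≤n) r≤a
  r≤2a : r ≤ 2 * a
  r≤2a = ≤-trans r≤a (m≤m+n a _)
  left : ∀ a X → a * (2 * suc (2 * a) * X) ≡ suc (2 * a) * (2 * a * X)
  left = solve-∀
  middle : ∀ a r Z → suc (2 * a) * (r * Z) ≡ (2 * a * r + r) * Z
  middle = solve-∀
  right : ∀ a r p E → (2 * a * r + 2 * a) * (p * E) ≡ a * (suc r * (2 * p * E))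
  right = solve-∀

RatioBound-mono : ∀ {X E r k} → r ≤′ k → RatioBound X E r → RatioBound X E k
RatioBound-mono ≤′-refl       h = h
RatioBound-mono (≤′-step r≤k) h = RatioBound-suc _ (RatioBound-mono r≤k h)

-- Matrices

dot : ∀ {k} → (Fin k → Bool) → Vec Bool k → Bool
dot u []      = false
dot u (b ∷ v) = u zero ∧ b xor dot (u ∘ suc) v

xor-interchange : ∀ a b c d → (a xor b) xor (c xor d) ≡ (a xor c) xor (b xor d)
xor-interchange a b c d = trans (xor-assoc a b _) (trans
  (cong (a xor_) (trans (sym (xor-assoc b c d)) (trans (cong (_xor d) (xor-comm b c)) (xor-assoc c b d))))
  (sym (xor-assoc a c _)))

dot-⊞ : ∀ {k} (u : Fin k → Bool) v w → dot u (v ⊞ w) ≡ dot u v xor dot u w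
dot-⊞ u []      []      = refl
dot-⊞ u (b ∷ v) (c ∷ w) = trans
  (cong₂ _xor_ (∧-distribˡ-xor (u zero) b c) (dot-⊞ (u ∘ suc) v w))
  (xor-interchange (u zero ∧ b) (u zero ∧ c) _ _)

dot-𝟎 : ∀ {k} (u : Fin k → Bool) → dot u 𝟎 ≡ false
dot-𝟎 {zero}  u = refl
dot-𝟎 {suc k} u = cong₂ _xor_ (∧-zeroʳ (u zero)) (dot-𝟎 (u ∘ suc))

dot-tabulate : ∀ {k} (u f : Fin k → Bool) → dot u (tabulate f) ≡ ⊕ k (λ l → u l ∧ f l)
dot-tabulate {zero}  u f = refl
dot-tabulate {suc k} u f = cong (u zero ∧ f zero xor_) (dot-tabulate (u ∘ suc) (f ∘ suc))

-- For a row `a`, this is one entry of the product of the chosen columns with a coefficient vector,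
-- before padding to `k` columns.
select : ∀ {n r} → (Fin n → Bool) → Vec Bool r → Vec (Fin n) r → Bool
select a []       []      = false
select a (b ∷ bs) (t ∷ T) = a t ∧ b xor select a bs T

-- The padding repeats the column `j` with coefficient `false` and so contributes nothing.
⊕-padRight : ∀ {n r k} (r≤k : r ≤ k) (a : Fin n → Bool) j (bs : Vec Bool r) (T : Vec (Fin n) r) →
  ⊕ k (λ l → a (lookup (padRight r≤k j T) l) ∧ lookup (padRight r≤k false bs) l) ≡ select a bs T
⊕-padRight (s≤s r≤k) a j (b ∷ bs) (t ∷ T) = cong (a t ∧ b xor_) (⊕-padRight r≤k a j bs T)
⊕-padRight {k = k} z≤n a j [] [] = vanish k
  where
  vanish : ∀ k → ⊕ k (λ l → a (lookup (replicate k j) l) ∧ lookup (replicate k false) l) ≡ false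
  vanish zero    = refl
  vanish (suc k) = cong₂ _xor_ (∧-zeroʳ (a j)) (vanish k)

bit-xor : ∀ a b → bit (a xor b) ≤ bit a + bit b
bit-xor true  true  = z≤n
bit-xor true  false = ≤-refl
bit-xor false b     = ≤-refl

module _ {k n : ℕ} (V : Fin n → Vec Bool k) where

  open BasisChoice V

  bit-select : ∀ {r} (ε : Fin n → Bool) (bs : Vec Bool r) T →
    bit (select ε bs T) ≤ used (bit ∘ ε) bs T
  bit-select ε []       []      = z≤n
  bit-select ε (b ∷ bs) (t ∷ T) = ≤-trans (bit-xor (ε t ∧ b) _)
    (+-mono-≤ (≤-reflexive (bit-∧ (ε t) b)) (bit-select ε bs T))
    where
    bit-∧ : ∀ a b → bit (a ∧ b) ≡ bit b * bit a
    bit-∧ true  true  = refl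
    bit-∧ true  false = refl
    bit-∧ false true  = refl
    bit-∧ false false = refl

  S-used : ∀ {A : Set} {r} (is : List A) (f : A → Fin n → ℕ) (bs : Vec Bool r) T →
    S is (λ i → used (f i) bs T) ≡ used (λ j → S is (λ i → f i j)) bs T
  S-used is f []       []      = S-zero is
  S-used is f (b ∷ bs) (t ∷ T) = trans (S-+ is _ _)
    (cong₂ _+_ (S-*ˡ is (bit b) _) (S-used is f bs T))

  -- Each selected entry is its approximation plus an error bit, and by linearity the approximations
  -- add up to that of the combination.
  select-split : ∀ {r} (u : Fin k → Bool) (a : Fin n → Bool) (bs : Vec Bool r) T →
    select a bs T ≡ select (λ j → a j xor dot u (V j)) bs T xor dot u (comb bs T)
  select-split u a []       []      = sym (dot-𝟎 u)
  select-split u a (b ∷ bs) (t ∷ T) = begin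
    a t ∧ b xor select a bs T
      ≡⟨ cong₂ _xor_ (head (a t) b) (select-split u a bs T) ⟩
    ((ε t ∧ b) xor dot u (scale b (V t))) xor (select ε bs T xor dot u (comb bs T))
      ≡⟨ xor-interchange (ε t ∧ b) _ _ _ ⟩
    (ε t ∧ b xor select ε bs T) xor (dot u (scale b (V t)) xor dot u (comb bs T))
      ≡⟨ cong ((ε t ∧ b xor select ε bs T) xor_) (dot-⊞ u (scale b (V t)) _) ⟨
    (ε t ∧ b xor select ε bs T) xor dot u (scale b (V t) ⊞ comb bs T) ∎
    where
    open ≡-Reasoning
    ε : Fin n → Bool
    ε j = a j xor dot u (V j)
    head : ∀ c b → c ∧ b ≡ ((c xor dot u (V t)) ∧ b) xor dot u (scale b (V t))
    head c true  = trans (∧-identityʳ c) (sym (trans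
      (cong (_xor dot u (V t)) (∧-identityʳ (c xor dot u (V t))))
      (trans (xor-assoc c (dot u (V t)) _)
        (trans (cong (c xor_) (xor-same (dot u (V t)))) (xor-identityʳ c)))))
    head c false = trans (∧-zeroʳ c) (sym (cong₂ _xor_ (∧-zeroʳ (c xor dot u (V t))) (dot-𝟎 u)))

  -- The approximations cancel because `V j` is the combination; what remains is the error bit of
  -- column `j` plus those of the columns used.
  residual : ∀ {r} (u : Fin k → Bool) (a : Fin n → Bool) (bs : Vec Bool r) T j → V j ≡ comb bs T →
    a j xor select a bs T ≡ (a j xor dot u (V j)) xor select (λ j → a j xor dot u (V j)) bs T
  residual u a bs T j Vj≡ = begin
    a j xor select a bs T                              ≡⟨ cong (a j xor_) (select-split u a bs T) ⟩
    a j xor (s xor dot u (comb bs T))                  ≡⟨ cong (λ v → a j xor (s xor dot u v)) (sym Vj≡) ⟩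
    a j xor (s xor dot u (V j))                        ≡⟨ cong (a j xor_) (xor-comm s _) ⟩
    a j xor (dot u (V j) xor s)                        ≡⟨ xor-assoc (a j) _ _ ⟨
    (a j xor dot u (V j)) xor s                        ∎
    where
    open ≡-Reasoning
    s : Bool
    s = select (λ j → a j xor dot u (V j)) bs T

-- Multiplication by 2 (2ᵏ - 1) turns the factor k/2 + 1 + k/(2 (2ᵏ - 1)) into (k + 2)(2ᵏ - 1) + k
-- and clears the denominators.
theorem1 : (k d n : ℕ) → 1 ≤ k → 1 ≤ n → (A : Mat d n) → (opt : ℕ) → IsOPT k A opt →
    Σ (Fin k → Fin n) λ σ → Σ (Mat k n) λ Q →
    2 * (2 ^ k ∸ 1) * ‖ A − (selectCols A σ · Q) ‖²
    ≤ ((k + 2) * (2 ^ k ∸ 1) + k) * opt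
theorem1 k d n@(suc _) _ _ A opt ((U , V' , U·V'≡opt) , _) = σ , Q , (begin
  2 * a * ‖ A − (selectCols A σ · Q) ‖²     ≤⟨ *-monoʳ-≤ (2 * a) total ⟩
  2 * a * (opt + X)                         ≡⟨ *-distribˡ-+ (2 * a) opt X ⟩
  2 * a * opt + 2 * a * X                   ≤⟨ +-monoʳ-≤ (2 * a * opt) ratio ⟩
  2 * a * opt + k * (2 ^ k * opt)           ≡⟨ cong (λ p → 2 * a * opt + k * (p * opt)) (suc-mersenne k) ⟨
  2 * a * opt + k * (suc a * opt)           ≡⟨ collect a k opt ⟩
  ((k + 2) * a + k) * opt                   ∎)
  where
  open ≤-Reasoning
  a : ℕ
  a = 2 ^ k ∸ 1
  V : Fin n → Vec Bool k
  V j = tabulate (λ l → V' l j)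
  open Columns V
  open BasisChoice V
  ε : Fin d → Fin n → Bool
  ε i j = A i j xor dot (U i) (V j)
  e : Fin n → ℕ
  e j = S (allFin d) (λ i → bit (ε i j))

  choice = cheapBasis e
  T = proj₁ choice
  ind = proj₁ (proj₂ choice)
  X : ℕ
  X = cost e isZero T

  norm≡ : (M : Mat d n) → ‖ M ‖² ≡ Σᶜ (λ j → S (allFin d) (λ i → bit (M i j)))
  norm≡ M = trans (∑≡S d _) (trans (S-cong (allFin d) (λ i → ∑≡S n _)) (S-swap (allFin d) (allFin n) _))

  Σe≡opt : Σᶜ e ≡ opt
  Σe≡opt = trans (S-cong (allFin n) λ j → S-cong (allFin d) λ i →
      cong (λ b → bit (A i j xor b)) (dot-tabulate (U i) (λ l → V' l j)))
    (trans (sym (norm≡ (A − (U · V')))) U·V'≡opt)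

  cost-empty : ∀ {r} (T : Vec (Fin n) r) → r ≡ 0 → cost e isZero T ≡ 0
  cost-empty [] _ = refl

  ratio : 2 * a * X ≤ k * (2 ^ k * opt)
  ratio = proj₂ (RatioBound-mono (≤⇒≤′ rank≤k) (cost-empty T ,
    subst (λ E → 2 * (2 ^ rank ∸ 1) * X ≤ rank * (2 ^ rank * E)) Σe≡opt (proj₂ (proj₂ choice))))

  rep : ∀ j → ∃[ bs ] (isZero (V j ⊞ comb bs T) ≡ true × used e bs T ≤ vectorCost e isZero T (V j))
  rep j = represent isZero-subspace e T ind (V j) (Indep⇒spanning T ind j)

  V≡comb : ∀ j → V j ≡ comb (proj₁ (rep j)) T
  V≡comb j = trans (sym (⊞-cancelʳ (V j) c))
    (trans (cong (_⊞ c) (isZero⇒≡𝟎 _ (proj₁ (proj₂ (rep j))))) (trans (⊞-comm 𝟎 c) (⊞-identityʳ c)))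
    where c = comb (proj₁ (rep j)) T

  -- Places beyond `rank` hold column `zero`, which exists because `n` is positive.
  σ : Fin k → Fin n
  σ = lookup (padRight rank≤k zero T)
  Q : Mat k n
  Q l j = lookup (padRight rank≤k false (proj₁ (rep j))) l

  entry : ∀ i j → bit ((A − (selectCols A σ · Q)) i j)
    ≤ bit (ε i j) + used (bit ∘ ε i) (proj₁ (rep j)) T
  entry i j = begin
    bit (A i j xor (selectCols A σ · Q) i j)
      ≡⟨ cong (λ b → bit (A i j xor b)) (⊕-padRight rank≤k (A i) zero (proj₁ (rep j)) T) ⟩
    bit (A i j xor select (A i) (proj₁ (rep j)) T)
      ≡⟨ cong bit (residual V (U i) (A i) (proj₁ (rep j)) T j (V≡comb j)) ⟩
    bit (ε i j xor select (ε i) (proj₁ (rep j)) T)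
      ≤⟨ bit-xor (ε i j) _ ⟩
    bit (ε i j) + bit (select (ε i) (proj₁ (rep j)) T)
      ≤⟨ +-monoʳ-≤ (bit (ε i j)) (bit-select V (ε i) (proj₁ (rep j)) T) ⟩
    bit (ε i j) + used (bit ∘ ε i) (proj₁ (rep j)) T ∎

  column : ∀ j → S (allFin d) (λ i → bit ((A − (selectCols A σ · Q)) i j))
    ≤ e j + vectorCost e isZero T (V j)
  column j = begin
    S (allFin d) (λ i → bit ((A − (selectCols A σ · Q)) i j))
      ≤⟨ S-mono (allFin d) (λ i → entry i j) ⟩
    S (allFin d) (λ i → bit (ε i j) + used (bit ∘ ε i) (proj₁ (rep j)) T)
      ≡⟨ S-+ (allFin d) _ _ ⟩
    e j + S (allFin d) (λ i → used (bit ∘ ε i) (proj₁ (rep j)) T)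
      ≡⟨ cong (e j +_) (S-used V (allFin d) (λ i → bit ∘ ε i) (proj₁ (rep j)) T) ⟩
    e j + used e (proj₁ (rep j)) T
      ≤⟨ +-monoʳ-≤ (e j) (proj₂ (proj₂ (rep j))) ⟩
    e j + vectorCost e isZero T (V j) ∎

  total : ‖ A − (selectCols A σ · Q) ‖² ≤ opt + X
  total = begin
    ‖ A − (selectCols A σ · Q) ‖²
      ≡⟨ norm≡ (A − (selectCols A σ · Q)) ⟩
    Σᶜ (λ j → S (allFin d) (λ i → bit ((A − (selectCols A σ · Q)) i j)))
      ≤⟨ S-mono (allFin n) column ⟩
    Σᶜ (λ j → e j + vectorCost e isZero T (V j))
      ≡⟨ trans (S-+ (allFin n) e _) (cong₂ _+_ Σe≡opt (Σ-vectorCost e isZero T)) ⟩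
    opt + X ∎

  collect : ∀ a k o → 2 * a * o + k * (suc a * o) ≡ ((k + 2) * a + k) * o
  collect = solve-∀
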